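{- Let $U=\{1,\dots,n\}$, $n\ge2$, with distance function $d$ and continuation probabilities $p_i\in[a,b]$ for all $i\in U$, where $0<a\le b<1$. Then the greedy algorithm provides a $\frac{a^2(1-b)^2}{a^2+b^2}$-approximation guarantee for MaxOHP. That is, for any ordering $O$ output by the greedy algorithm, $$\mathcal{H}(O)\ \ge\ \frac{a^2(1-b)^2}{a^2+b^2}\,\max_{O'}\mathcal{H}(O'),$$ the maximum being over all orderings $O'$ of $U$.
   Context: The distance function $d:U\times U\to\mathbb{R}_{\ge0}$ is symmetric with $d(i,i)=0$. For a sequence $O=(\pi(1),\dots,\pi(m))$ of distinct items, let $O_k=(\pi(1),\dots,\pi(k))$ and $p_{O_k}=\prod_{t=1}^kp_{\pi(t)}$. For an ordering $O$ of $U$ the ordered Hamiltonian path objective is $\mathcal{H}(O)=\sum_{i=1}^{n-1}W_{O_i}\,d(\pi(i),\pi(i+1))$ with $W_{O_i}=\sum_{j=i+1}^np_{O_j}$. MaxOHP asks for an ordering of $U$ maximizing $\mathcal{H}$. For a sequence $O=(\pi(1),\dots,\pi(m))$ the sequential sum diversity is $\mathcal{S}_+(O)=\sum_{i=1}^{m-1}p_{O_{i+1}}\sum_{t=1}^{i}d(\pi(i+1),\pi(t))$. Greedy algorithm: choose $O_2=(\pi(1),\pi(2))$ to be a pair of distinct items maximizing $p_{\pi(1)}p_{\pi(2)}d(\pi(1),\pi(2))$; then for $t=2,\dots,n-1$ append to $O_t$ an item $u\in U\setminus O_t$ maximizing $\mathcal{S}_+(O_t\|v)-\mathcal{S}_+(O_t)$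 over $v\in U\setminus O_t$ (where $\|$ is concatenation), obtaining $O_{t+1}=O_t\|u$. Output $O_n$. Ties are broken arbitrarily. -}

module Defs where

open import Algebra.Bundles using (CommutativeRing)
open import Algebra.Core using (Op₁)
import Algebra.Properties.CommutativeMonoid.Sum as Summation
open import Data.Fin.Base using (Fin; suc; toℕ; inject; inject₁)
open import Data.List.Base as List using (List)
open import Data.Nat.Base using (ℕ; suc; _∸_) renaming (_+_ to _+ℕ_)
open import Data.Product.Base using (_×_)
open import Data.Vec.Base using (Vec; []; _∷_; _∷ʳ_; lookup; toList)
open import Data.Vec.Membership.Propositional using (_∉_)
open import Data.Vec.Relation.Unary.Unique.Propositional using (Unique)
open import Level using (_⊔_) renaming (suc to lsuc)
open import Relation.Binary.Core using (Rel)
open import Relation.Binary.PropositionalEquality.Core using (_≢_)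
open import Relation.Binary.Structures using (IsTotalOrder)
open import Relation.Nullary.Negation using (¬_)

-- Totally ordered fields, which stand in for ℝ: classically ℝ is one of them.
-- Completeness is not assumed.  As in a classical presentation, _⁻¹ is total
-- and its value at 0# is unconstrained.
record OrderedField c ℓ₁ ℓ₂ : Set (lsuc (c ⊔ ℓ₁ ⊔ ℓ₂)) where
  infix  4 _≤_ _<_
  infix  8 _⁻¹
  infixl 7 _/_
  field
    commutativeRing : CommutativeRing c ℓ₁

  open CommutativeRing commutativeRing public

  field
    _≤_          : Rel Carrier ℓ₂
    isTotalOrder : IsTotalOrder _≈_ _≤_
    _⁻¹          : Op₁ Carrier
    0≉1          : ¬ 0# ≈ 1#
    ⁻¹-inverseʳ  : ∀ x → ¬ x ≈ 0# → x * x ⁻¹ ≈ 1#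
    +-monoʳ-≤    : ∀ x {y z} → y ≤ z → x + y ≤ x + z
    *-nonNeg     : ∀ {x y} → 0# ≤ x → 0# ≤ y → 0# ≤ x * y

  _<_ : Rel Carrier (ℓ₁ ⊔ ℓ₂)
  x < y = (x ≤ y) × (¬ x ≈ y)

  _/_ : Carrier → Carrier → Carrier
  x / y = x * y ⁻¹

module Diversity {c ℓ₁ ℓ₂} (F : OrderedField c ℓ₁ ℓ₂) {k : ℕ}
  (p : Fin (suc k) → OrderedField.Carrier F)
  (d : Fin (suc k) → Fin (suc k) → OrderedField.Carrier F)
  where

  open OrderedField F
  open Summation +-commutativeMonoid using (sum-syntax)

  U : Set
  U = Fin (suc k)

  -- Lengths and prefix lengths are the usual ones, but positions are counted
  -- from 0: π(i) is found at the position whose toℕ is i ∸ 1.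

  -- p_{O_l} = ∏_{t=1}^l p_{π(t)}
  prefixProb : ∀ {m} → Vec U m → ℕ → Carrier
  prefixProb O l = List.foldr _*_ 1# (List.map p (List.take l (toList O)))

  -- W_{O_i} = ∑_{j=i+1}^m p_{O_j}, with j = i + 1 + s
  W : ∀ {m} → Vec U m → ℕ → Carrier
  W {m} O i = ∑[ s < m ∸ i ] prefixProb O (i +ℕ suc (toℕ s))

  -- 𝓗(O) = ∑_{i=1}^{m-1} W_{O_i} d(π(i), π(i+1))
  ℋ : ∀ {m} → Vec U (suc m) → Carrier
  ℋ {m} O =
    ∑[ i < m ] (W O (suc (toℕ i)) * d (lookup O (inject₁ i)) (lookup O (suc i)))

  -- 𝓢₊(O) = ∑_{i=1}^{m-1} p_{O_{i+1}} ∑_{t=1}^i d(π(i+1), π(t))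
  𝒮₊ : ∀ {m} → Vec U (suc m) → Carrier
  𝒮₊ {m} O =
    ∑[ i < m ] (prefixProb O (suc (suc (toℕ i))) *
      (∑[ t < suc (toℕ i) ] (d (lookup O (suc i)) (lookup O (inject {i = suc i} t)))))

  -- Greedy O holds iff O can be the sequence O_t of a run of the greedy
  -- algorithm, under some way of breaking ties.
  data Greedy : ∀ {t} → Vec U t → Set (c ⊔ ℓ₁ ⊔ ℓ₂) where
    start : ∀ {u v} → u ≢ v →
            (∀ u′ v′ → u′ ≢ v′ → p u′ * p v′ * d u′ v′ ≤ p u * p v * d u v) →
            Greedy (u ∷ v ∷ [])
    step  : ∀ {t} {O : Vec U (suc (suc t))} {u} → Greedy O → u ∉ O →
            (∀ v → v ∉ O → 𝒮₊ (O ∷ʳ v) - 𝒮₊ O ≤ 𝒮₊ (O ∷ʳ u) - 𝒮₊ O) →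
            Greedy (O ∷ʳ u)

  -- An ordering of U consists of n = suc k distinct items.
  IsOptimal : Vec U (suc k) → Set ℓ₂
  IsOptimal O* =
    Unique O* × (∀ (O′ : Vec U (suc k)) → Unique O′ → ℋ O′ ≤ ℋ O*)

{-# OPTIONS --safe #-}

-- The first pair (u, v) chosen by greedy already suffices.  Let
-- M = p_u p_v d(u,v), which is at least p_x p_y d(x,y) for all x ≠ y.  The weight
-- W_{O_i} of an ordering is p_{O_{i+1}} (1 + p + p p′ + ⋯) ≤ p_{O_{i+1}} / (1 - b),
-- and p_{O_{i-1}} ≤ b^{i-1}, so the i-th term of 𝓗 is at most b^{i-1} M / (1 - b)
-- and 𝓗 ≤ M / (1 - b)² for every ordering.  The greedy output has 𝓗 ≥ M from its
-- first term alone.  Hence the ratio is at least (1 - b)², and a² / (a² + b²) ≤ 1.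
module Submission where

import Algebra.Properties.AbelianGroup as AbelianGroupProperties
import Algebra.Properties.Ring as RingProperties
import Algebra.Properties.Semiring.Sum as SemiringSum
import Algebra.Solver.Ring.NaturalCoefficients.Default as SemiringSolver
open import Data.Fin.Base using (Fin; suc; toℕ; inject₁)
import Data.Fin.Properties as Fin
import Data.List.Extrema as Extrema
open import Data.List.Base as List using (List)
open import Data.List.Membership.Propositional using (_∈_)
open import Data.List.Membership.Propositional.Properties
  using (∈-allFin; ∈-cartesianProductWith⁺; ∈-filter⁺)
import Data.List.Relation.Unary.All as ListAll
open import Data.List.Relation.Unary.All.Properties using (all-filter)
open import Data.List.Relation.Unary.Any using (here)
open import Data.Nat.Base using (ℕ; zero; suc; _∸_)
open import Data.Product.Base using (_×_; _,_; proj₁; proj₂; ∃-syntax)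
open import Data.Sum.Base using (inj₁; inj₂)
open import Data.Unit.Polymorphic.Base using (⊤)
open import Data.Vec.Base using (Vec; []; _∷_; allFin; lookup)
open import Data.Vec.Relation.Unary.All using (_∷_)
open import Data.Vec.Relation.Unary.AllPairs using (allPairs?; _∷_)
open import Data.Vec.Relation.Unary.Unique.Propositional using (Unique)
open import Data.Vec.Relation.Unary.Unique.Propositional.Properties using (tabulate⁺)
open import Function.Base using (id)
open import Relation.Binary.Bundles using (TotalOrder)
import Relation.Binary.Reasoning.PartialOrder as PartialOrderReasoning
open import Relation.Binary.PropositionalEquality.Core as ≡ using (_≢_)
open import Relation.Nullary.Decidable using (¬?)
open import Relation.Nullary.Negation using (¬_)
open import Relation.Unary using (Decidable)
open import Defs

-- Order and inverse laws in an ordered field.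

module OrderedFieldProperties {c ℓ₁ ℓ₂} (F : OrderedField c ℓ₁ ℓ₂) where
  open OrderedField F
  open RingProperties ring using (-‿distribˡ-*; -‿distribʳ-*; x[y-z]≈xy-xz)
  open AbelianGroupProperties +-abelianGroup using () renaming (⁻¹-involutive to -‿involutive)
  open SemiringSolver commutativeSemiring using (solve; _:=_; _:*_)

  ≤-totalOrder : TotalOrder c ℓ₁ ℓ₂
  ≤-totalOrder = record { isTotalOrder = isTotalOrder }

  open TotalOrder ≤-totalOrder public
    using (poset; total; antisym; ≤-respˡ-≈; ≤-respʳ-≈)
    renaming (refl to ≤-refl; trans to ≤-trans)

  open PartialOrderReasoning poset

  +-mono-≤ : ∀ {w x y z} → w ≤ x → y ≤ z → w + y ≤ x + z
  +-mono-≤ {w} {x} {y} {z} w≤x y≤z = begin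
    w + y ≤⟨ +-monoʳ-≤ w y≤z ⟩
    w + z ≈⟨ +-comm w z ⟩
    z + w ≤⟨ +-monoʳ-≤ z w≤x ⟩
    z + x ≈⟨ +-comm z x ⟩
    x + z ∎

  +-nonNeg : ∀ {x y} → 0# ≤ x → 0# ≤ y → 0# ≤ x + y
  +-nonNeg 0≤x 0≤y = ≤-respˡ-≈ (+-identityʳ 0#) (+-mono-≤ 0≤x 0≤y)

  x≤x+y : ∀ x {y} → 0# ≤ y → x ≤ x + y
  x≤x+y x 0≤y = ≤-respˡ-≈ (+-identityʳ x) (+-monoʳ-≤ x 0≤y)

  x≤y⇒0≤y-x : ∀ {x y} → x ≤ y → 0# ≤ y - x
  x≤y⇒0≤y-x {x} {y} x≤y = begin
    0#      ≈⟨ -‿inverseˡ x ⟨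
    - x + x ≤⟨ +-monoʳ-≤ (- x) x≤y ⟩
    - x + y ≈⟨ +-comm (- x) y ⟩
    y - x   ∎

  y-x+x≈y : ∀ y x → (y - x) + x ≈ y
  y-x+x≈y y x = trans (+-assoc y (- x) x) (trans (+-congˡ (-‿inverseˡ x)) (+-identityʳ y))

  0≤y-x⇒x≤y : ∀ {x y} → 0# ≤ y - x → x ≤ y
  0≤y-x⇒x≤y {x} {y} 0≤y-x = begin
    x           ≤⟨ x≤x+y x 0≤y-x ⟩
    x + (y - x) ≈⟨ +-comm x (y - x) ⟩
    (y - x) + x ≈⟨ y-x+x≈y y x ⟩
    y           ∎

  *-monoˡ-≤ : ∀ {x y z} → 0# ≤ x → y ≤ z → x * y ≤ x * z
  *-monoˡ-≤ {x} {y} {z} 0≤x y≤z =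
    0≤y-x⇒x≤y (≤-respʳ-≈ (x[y-z]≈xy-xz x z y) (*-nonNeg 0≤x (x≤y⇒0≤y-x y≤z)))

  *-monoʳ-≤ : ∀ {x y z} → 0# ≤ x → y ≤ z → y * x ≤ z * x
  *-monoʳ-≤ {x} {y} {z} 0≤x y≤z = begin
    y * x ≈⟨ *-comm y x ⟩
    x * y ≤⟨ *-monoˡ-≤ 0≤x y≤z ⟩
    x * z ≈⟨ *-comm x z ⟩
    z * x ∎

  x*x-nonNeg : ∀ x → 0# ≤ x * x
  x*x-nonNeg x with total 0# x
  ... | inj₁ 0≤x = *-nonNeg 0≤x 0≤x
  ... | inj₂ x≤0 = begin
    0#            ≤⟨ *-nonNeg 0≤-x 0≤-x ⟩
    - x * - x     ≈⟨ -‿distribˡ-* x (- x) ⟨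
    - (x * - x)   ≈⟨ -‿cong (-‿distribʳ-* x x) ⟨
    - - (x * x)   ≈⟨ -‿involutive (x * x) ⟩
    x * x         ∎
    where
    0≤-x : 0# ≤ - x
    0≤-x = ≤-respʳ-≈ (+-identityˡ (- x)) (x≤y⇒0≤y-x x≤0)

  0≤1 : 0# ≤ 1#
  0≤1 = ≤-respʳ-≈ (*-identityʳ 1#) (x*x-nonNeg 1#)

  -- y⁻¹ = y · (y⁻¹)² has the sign of y.
  ⁻¹-nonNeg : ∀ {y} → 0# < y → 0# ≤ y ⁻¹
  ⁻¹-nonNeg {y} (0≤y , 0≉y) = begin
    0#                 ≤⟨ *-nonNeg 0≤y (x*x-nonNeg (y ⁻¹)) ⟩
    y * (y ⁻¹ * y ⁻¹)  ≈⟨ *-assoc y (y ⁻¹) (y ⁻¹) ⟨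
    y * y ⁻¹ * y ⁻¹    ≈⟨ *-congʳ (⁻¹-inverseʳ y λ y≈0 → 0≉y (sym y≈0)) ⟩
    1# * y ⁻¹          ≈⟨ *-identityˡ (y ⁻¹) ⟩
    y ⁻¹               ∎

  -- If `x * x` vanished, multiplying it by the square of `x ⁻¹` would give `0# ≈ 1#`.
  x*x-pos : ∀ {x} → ¬ x ≈ 0# → 0# < x * x
  x*x-pos {x} x≉0 = x*x-nonNeg x , λ 0≈x*x → 0≉1 (begin-equality
    0#                        ≈⟨ zeroˡ (x ⁻¹ * x ⁻¹) ⟨
    0# * (x ⁻¹ * x ⁻¹)        ≈⟨ *-congʳ 0≈x*x ⟩
    x * x * (x ⁻¹ * x ⁻¹)     ≈⟨ solve 2 (λ x y → x :* x :* (y :* y) := x :* y :* (x :* y)) refl x (x ⁻¹) ⟩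
    (x * x ⁻¹) * (x * x ⁻¹)   ≈⟨ *-cong (⁻¹-inverseʳ x x≉0) (⁻¹-inverseʳ x x≉0) ⟩
    1# * 1#                   ≈⟨ *-identityʳ 1# ⟩
    1#                        ∎)

  <-≤-trans : ∀ {x y z} → x < y → y ≤ z → x < z
  <-≤-trans (x≤y , x≉y) y≤z =
    ≤-trans x≤y y≤z , λ x≈z → x≉y (antisym x≤y (≤-respʳ-≈ (sym x≈z) y≤z))

  x/y≤1 : ∀ {x y} → 0# < y → x ≤ y → x / y ≤ 1#
  x/y≤1 {x} {y} 0<y@(_ , 0≉y) x≤y = begin
    x * y ⁻¹ ≤⟨ *-monoʳ-≤ (⁻¹-nonNeg 0<y) x≤y ⟩
    y * y ⁻¹ ≈⟨ ⁻¹-inverseʳ y (λ y≈0 → 0≉y (sym y≈0)) ⟩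
    1#       ∎

-- Existence of an optimal ordering, by finite enumeration.

vectors : ∀ k n → List (Vec (Fin k) n)
vectors k zero    = [] List.∷ List.[]
vectors k (suc n) = List.cartesianProductWith _∷_ (List.allFin k) (vectors k n)

∈-vectors : ∀ {k n} (v : Vec (Fin k) n) → v ∈ vectors k n
∈-vectors []      = here ≡.refl
∈-vectors (x ∷ v) = ∈-cartesianProductWith⁺ _∷_ (∈-allFin x) (∈-vectors v)

module PathBounds {c ℓ₁ ℓ₂} (F : OrderedField c ℓ₁ ℓ₂) {k : ℕ}
  (d : Fin (suc k) → Fin (suc k) → OrderedField.Carrier F)
  (0≤d : ∀ i j → OrderedField._≤_ F (OrderedField.0# F) (d i j))
  (p : Fin (suc k) → OrderedField.Carrier F)
  (0≤p : ∀ i → OrderedField._≤_ F (OrderedField.0# F) (p i))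
  where

  open OrderedField F
  open Diversity F p d
  open OrderedFieldProperties F
  open PartialOrderReasoning poset
  open SemiringSum semiring using (sum; sum-cong-≋; *-distribˡ-sum)
  open SemiringSolver commutativeSemiring using (solve; _:=_; _:*_; _:+_; con)

  exists-optimal : ∃[ O* ] IsOptimal O*
  exists-optimal = argmax ℋ ⊥ orderings
    , argmax-all ℋ (tabulate⁺ id) (all-filter unique? (vectors _ _))
    , λ O′ O′! → ListAll.lookup (f[xs]≤f[argmax] {f = ℋ} ⊥ orderings)
                   (∈-filter⁺ unique? (∈-vectors O′) O′!)
    where
    open Extrema ≤-totalOrder using (argmax; argmax-all; f[xs]≤f[argmax])

    unique? : Decidable (Unique {A = U} {n = suc k})
    unique? = allPairs? λ x y → ¬? (x Fin.≟ y)

    orderings : List (Vec U (suc k))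
    orderings = List.filter unique? (vectors _ _)

    -- `argmax` may return its default, so the default must itself be an ordering: the identity one.
    ⊥ : Vec U (suc k)
    ⊥ = allFin (suc k)

  -- Recursions for `W` and `ℋ`, and the lower bound from the first pair.

  -- Every nonempty prefix of `x ∷ O` contributes a factor `p x`; what remains are all prefixes of
  -- `O`, the empty one giving the summand `1#`.
  W-zero : ∀ {m} x (O : Vec U m) → W (x ∷ O) 0 ≈ p x * (1# + W O 0)
  W-zero {m} x O = sym (*-distribˡ-sum (p x) (λ (s : Fin (suc m)) → prefixProb O (toℕ s)))

  W-suc : ∀ {m} x (O : Vec U m) i → W (x ∷ O) (suc i) ≈ p x * W O i
  W-suc {m} x O i = sym (*-distribˡ-sum {m ∸ i} (p x) _)

  -- The weight of each edge contains `p x`, since every prefix counted there starts with `x`.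
  -- Factoring it out leaves the first edge and the objective of the tail, which opens `ℋ` to
  -- induction.
  ℋ-∷ : ∀ {m} x y (O : Vec U m) →
        ℋ (x ∷ y ∷ O) ≈ p x * (W (y ∷ O) 0 * d x y + ℋ (y ∷ O))
  ℋ-∷ {m} x y O = begin-equality
    ℋ (x ∷ y ∷ O)                                          ≈⟨ +-cong (*-congʳ (W-suc x (y ∷ O) 0)) tail-terms ⟩
    p x * W (y ∷ O) 0 * d x y + p x * ℋ (y ∷ O)            ≈⟨ +-congʳ (*-assoc _ _ _) ⟩
    p x * (W (y ∷ O) 0 * d x y) + p x * ℋ (y ∷ O)          ≈⟨ distribˡ _ _ _ ⟨
    p x * (W (y ∷ O) 0 * d x y + ℋ (y ∷ O))                ∎
    where
    δ : Fin m → Carrier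
    δ i = d (lookup (y ∷ O) (inject₁ i)) (lookup (y ∷ O) (suc i))

    tail-terms : sum (λ i → W (x ∷ y ∷ O) (suc (suc (toℕ i))) * δ i) ≈ p x * ℋ (y ∷ O)
    tail-terms = trans
      (sum-cong-≋ {m} λ i → trans (*-congʳ (W-suc x (y ∷ O) (suc (toℕ i)))) (*-assoc _ _ (δ i)))
      (sym (*-distribˡ-sum {m} (p x) (λ i → W (y ∷ O) (suc (toℕ i)) * δ i)))

  W-nonNeg : ∀ {m} (O : Vec U m) → 0# ≤ W O 0
  W-nonNeg []      = ≤-refl
  W-nonNeg (x ∷ O) =
    ≤-respʳ-≈ (sym (W-zero x O)) (*-nonNeg (0≤p x) (+-nonNeg 0≤1 (W-nonNeg O)))

  ℋ-nonNeg : ∀ {m} (O : Vec U (suc m)) → 0# ≤ ℋ O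
  ℋ-nonNeg (x ∷ [])    = ≤-refl
  ℋ-nonNeg (x ∷ y ∷ O) = ≤-respʳ-≈ (sym (ℋ-∷ x y O)) (*-nonNeg (0≤p x)
    (+-nonNeg (*-nonNeg (W-nonNeg (y ∷ O)) (0≤d x y)) (ℋ-nonNeg (y ∷ O))))

  -- Of the weight of the first edge only the two-item prefix is kept; everything dropped is
  -- nonnegative.
  first-pair≤ℋ : ∀ {m} x y (O : Vec U m) → p x * p y * d x y ≤ ℋ (x ∷ y ∷ O)
  first-pair≤ℋ x y O = begin
    p x * p y * d x y                            ≈⟨ *-assoc _ _ _ ⟩
    p x * (p y * d x y)                          ≤⟨ *-monoˡ-≤ (0≤p x) (*-monoʳ-≤ (0≤d x y) py≤W) ⟩
    p x * (W (y ∷ O) 0 * d x y)                  ≤⟨ *-monoˡ-≤ (0≤p x) (x≤x+y _ (ℋ-nonNeg (y ∷ O))) ⟩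
    p x * (W (y ∷ O) 0 * d x y + ℋ (y ∷ O))      ≈⟨ ℋ-∷ x y O ⟨
    ℋ (x ∷ y ∷ O)                                ∎
    where
    py≤W : p y ≤ W (y ∷ O) 0
    py≤W = begin
      p y                 ≈⟨ *-identityʳ _ ⟨
      p y * 1#            ≤⟨ *-monoˡ-≤ (0≤p y) (x≤x+y 1# (W-nonNeg O)) ⟩
      p y * (1# + W O 0)  ≈⟨ W-zero y O ⟨
      W (y ∷ O) 0         ∎

  PairBound : Carrier → Set ℓ₂
  PairBound M = ∀ u v → u ≢ v → p u * p v * d u v ≤ M

  StartsMaximally : ∀ {m} → Vec U m → Set ℓ₂
  StartsMaximally (u ∷ v ∷ _) = PairBound (p u * p v * d u v)
  StartsMaximally _           = ⊤

  greedy-startsMaximally : ∀ {m} {O : Vec U m} → Greedy O → StartsMaximally O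
  greedy-startsMaximally (start _ max) = max
  -- Exposing two items of `O` lets `O ∷ʳ u` reduce to a vector with the same first pair, so the
  -- induction hypothesis is already the goal.
  greedy-startsMaximally (step {O = _ ∷ _ ∷ _} g _ _) = greedy-startsMaximally g

  greedy⇒ℋ≥pairBound : ∀ {m} (O : Vec U (suc (suc m))) → Greedy O →
                       ∃[ M ] (0# ≤ M × PairBound M × M ≤ ℋ O)
  greedy⇒ℋ≥pairBound (u ∷ v ∷ O) g = p u * p v * d u v
    , *-nonNeg (*-nonNeg (0≤p u) (0≤p v)) (0≤d u v)
    , greedy-startsMaximally g
    , first-pair≤ℋ u v O

  -- Writing r for 1 - b keeps subtraction out of the identities below.
  module Upper (r b : Carrier) (r+b≈1 : r + b ≈ 1#) (0≤r : 0# ≤ r) (0≤b : 0# ≤ b)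
    (p≤b : ∀ i → p i ≤ b) where

    -- The geometric series bound, multiplied out to avoid division. The two statements are mutually
    -- recursive: `b` for the tail yields `r + b ≈ 1#`, leaving exactly `p x`, and `p x ≤ b` closes
    -- the loop. The sharper form keeps the probability of the head, which is needed to form pair
    -- products.
    r*W≤b   : ∀ {m} (O : Vec U m) → r * W O 0 ≤ b
    r*W-∷≤p : ∀ {m} x (O : Vec U m) → r * W (x ∷ O) 0 ≤ p x

    r*W≤b []      = ≤-respˡ-≈ (sym (zeroʳ r)) 0≤b
    r*W≤b (x ∷ O) = ≤-trans (r*W-∷≤p x O) (p≤b x)

    r*W-∷≤p x O = begin
      r * W (x ∷ O) 0         ≈⟨ *-congˡ (W-zero x O) ⟩
      r * (p x * (1# + W O 0))
        ≈⟨ solve 3 (λ r p w → r :* (p :* (con 1 :+ w)) := p :* (r :+ r :* w)) refl r (p x) (W O 0) ⟩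
      p x * (r + r * W O 0)   ≤⟨ *-monoˡ-≤ (0≤p x) (+-monoʳ-≤ r (r*W≤b O)) ⟩
      p x * (r + b)           ≈⟨ *-congˡ r+b≈1 ⟩
      p x * 1#                ≈⟨ *-identityʳ _ ⟩
      p x                     ∎

    -- Induction with `M` fixed: the first edge accounts for at most `r * M`, the tail, discounted
    -- by `p x ≤ b`, for at most `b * M`, and these shares add up to `M`.
    r²*ℋ≤pairBound : ∀ {M} → 0# ≤ M → PairBound M →
                     ∀ {m} (O : Vec U (suc m)) → Unique O → r * r * ℋ O ≤ M
    r²*ℋ≤pairBound 0≤M bound (x ∷ []) _ = ≤-respˡ-≈ (sym (zeroʳ (r * r))) 0≤M
    r²*ℋ≤pairBound {M} 0≤M bound (x ∷ y ∷ O) ((x≢y ∷ _) ∷ O!) = begin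
      r * r * ℋ (x ∷ y ∷ O)
        ≈⟨ *-congˡ (ℋ-∷ x y O) ⟩
      r * r * (p x * (w * d x y + h))
        -- On the first edge one factor `r` is spent on turning `w` into `p y`, which completes the
        -- pair product; the other survives as the share `r` of `M`. The tail keeps both for the
        -- induction hypothesis.
        ≈⟨ solve 5 (λ r p w d h → r :* r :* (p :* (w :* d :+ h))
             := r :* (p :* (r :* w) :* d) :+ p :* (r :* r :* h)) refl r (p x) w (d x y) h ⟩
      r * (p x * (r * w) * d x y) + p x * (r * r * h)
        ≤⟨ +-mono-≤
             (*-monoˡ-≤ 0≤r (*-monoʳ-≤ (0≤d x y) (*-monoˡ-≤ (0≤p x) (r*W-∷≤p y O))))
             (*-monoˡ-≤ (0≤p x) (r²*ℋ≤pairBound 0≤M bound (y ∷ O) O!)) ⟩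
      r * (p x * p y * d x y) + p x * M
        ≤⟨ +-mono-≤ (*-monoˡ-≤ 0≤r (bound x y x≢y)) (*-monoʳ-≤ 0≤M (p≤b x)) ⟩
      r * M + b * M
        ≈⟨ distribʳ M r b ⟨
      (r + b) * M
        ≈⟨ *-congʳ r+b≈1 ⟩
      1# * M
        ≈⟨ *-identityˡ M ⟩
      M ∎
      where
      w = W (y ∷ O) 0
      h = ℋ (y ∷ O)

-- Combining the two bounds into the approximation ratio.

corollary3 : ∀ {c ℓ₁ ℓ₂} (F : OrderedField c ℓ₁ ℓ₂) →
    let open OrderedField F in
    (m : ℕ) → let n = suc (suc m) in
    (d : Fin n → Fin n → Carrier) →
    (∀ i j → 0# ≤ d i j) →
    (∀ i j → d i j ≈ d j i) →
    (∀ i → d i i ≈ 0#) →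
    (p : Fin n → Carrier) (a b : Carrier) →
    0# < a → a ≤ b → b < 1# →
    (∀ i → (a ≤ p i) × (p i ≤ b)) →
    let open Diversity F p d in
    (O : Vec U n) → Greedy O →
    ∃[ O* ] (IsOptimal O* ×
    (a * a * ((1# - b) * (1# - b))) / (a * a + b * b) * ℋ O* ≤ ℋ O)
corollary3 F m d 0≤d _ _ p a b (0≤a , 0≉a) a≤b (b≤1 , _) a≤p≤b O greedy =
  let O* , optimal@(O*! , _) = exists-optimal
      M , 0≤M , bound , M≤ℋO  = greedy⇒ℋ≥pairBound O greedy
      r = 1# - b
      s = a * a + b * b
      h = ℋ O*
  in O* , optimal , (begin
    (a * a * (r * r)) / s * h
      ≈⟨ solve 4 (λ q r t h → q :* (r :* r) :* t :* h := q :* t :* (r :* r :* h))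
           refl (a * a) r (s ⁻¹) h ⟩
    -- The ratio `a * a / s` is at most `1#` and can be replaced by it because `r * r * h` is
    -- nonnegative.
    (a * a) / s * (r * r * h)
      ≤⟨ *-monoʳ-≤ (*-nonNeg (*-nonNeg 0≤r 0≤r) (ℋ-nonNeg O*)) (x/y≤1 0<s a²≤s) ⟩
    1# * (r * r * h)
      ≈⟨ *-identityˡ _ ⟩
    r * r * h
      ≤⟨ r²*ℋ≤pairBound 0≤M bound O* O*! ⟩
    M
      ≤⟨ M≤ℋO ⟩
    ℋ O ∎)
  where
  open OrderedField F
  open OrderedFieldProperties F
  open Diversity F p d
  open PathBounds F d 0≤d p (λ i → ≤-trans 0≤a (proj₁ (a≤p≤b i)))
  open PartialOrderReasoning poset
  open SemiringSolver commutativeSemiring using (solve; _:=_; _:*_)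

  0≤r : 0# ≤ 1# - b
  0≤r = x≤y⇒0≤y-x b≤1

  open Upper (1# - b) b (y-x+x≈y 1# b) 0≤r (≤-trans 0≤a a≤b) (λ i → proj₂ (a≤p≤b i))

  a²≤s : a * a ≤ a * a + b * b
  a²≤s = x≤x+y (a * a) (x*x-nonNeg b)

  -- Ensures that `s ⁻¹` is a genuine inverse, as the inverse of zero is unconstrained.
  0<s : 0# < a * a + b * b
  0<s = <-≤-trans (x*x-pos λ a≈0 → 0≉a (sym a≈0)) a²≤s
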